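{- There are, up to isomorphism, exactly two cubic graphs of order $6$, namely the complete bipartite graph $K_{3,3}$ and the triangular prism $K_3\,\square\,K_2$, and both have coalition number $6$: $C(K_{3,3})=C(K_3\,\square\,K_2)=6$.
   Context: All graphs are finite and simple; a cubic graph is a $3$-regular graph (not necessarily connected), and the order of a graph is its number of vertices. A set $S\subseteq V(G)$ is a dominating set of $G$ if every vertex of $V(G)\setminus S$ has at least one neighbor in $S$. Two disjoint sets $V_1,V_2\subseteq V(G)$ form a coalition if neither $V_1$ nor $V_2$ is a dominating set of $G$ but $V_1\cup V_2$ is a dominating set of $G$. A coalition partition (c-partition) of $G$ is a partition $\pi=\{V_1,\dots,V_k\}$ of $V(G)$ into nonempty sets such that every $V_i\in\pi$ is either a singleton dominating set of $G$, or is not a dominating set of $G$ but forms a coalition with another non-dominating set $V_j\in\pi$. The coalition number $C(G)$ is the maximum $k$ such that $G$ has a c-partition with $k$ sets. -}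

module Defs where

open import Data.Empty using (⊥)
open import Data.Fin using (Fin; splitAt; remQuot; _≟_)
open import Data.Fin.Permutation using (Permutation; _⟨$⟩ʳ_)
open import Data.Fin.Subset using (Subset; _∈_; _∉_; _∩_; _∪_; ∣_∣; Nonempty; Empty)
open import Data.Nat using (ℕ; _+_; _*_; _≤_)
open import Data.Product using (_×_; _,_; ∃; ∃-syntax)
open import Data.Sum using (_⊎_; inj₁; inj₂)
open import Data.Unit using (⊤)
open import Data.Vec using (tabulate)
open import Function using (_∘_)
open import Function.Bundles using (_⇔_)
open import Level using (0ℓ)
open import Relation.Binary using (Rel; Symmetric; Irreflexive; Decidable)
open import Relation.Binary.PropositionalEquality using (_≡_; _≢_; refl; sym; ≢-sym)
open import Relation.Nullary using (¬_; yes; no; does)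
open import Relation.Nullary.Decidable using (¬?; _×-dec_; _⊎-dec_)

-- Finite simple graphs of order n, with vertex set Fin n.  Adjacency is
-- required to be decidable so that vertex degrees can be counted.
record Graph (n : ℕ) : Set₁ where
  field
    Adj        : Rel (Fin n) 0ℓ
    adj?       : Decidable Adj
    adj-sym    : Symmetric Adj
    adj-irrefl : Irreflexive _≡_ Adj

  neighbourhood : Fin n → Subset n
  neighbourhood v = tabulate (does ∘ adj? v)

  degree : Fin n → ℕ
  degree v = ∣ neighbourhood v ∣

open Graph public

IsRegular : ∀ {n} → ℕ → Graph n → Set
IsRegular d G = ∀ v → degree G v ≡ d

IsCubic : ∀ {n} → Graph n → Set
IsCubic = IsRegular 3

infix 4 _≅_

_≅_ : ∀ {m n} → Graph m → Graph n → Set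
_≅_ {m} {n} G H = ∃ λ (f : Permutation m n) →
  ∀ u v → Adj G u v ⇔ Adj H (f ⟨$⟩ʳ u) (f ⟨$⟩ʳ v)

complete : ∀ n → Graph n
complete n = record
  { Adj        = _≢_
  ; adj?       = λ u v → ¬? (u ≟ v)
  ; adj-sym    = ≢-sym
  ; adj-irrefl = λ u≡v u≢v → u≢v u≡v
  }

OppositeSides : ∀ {A B : Set} → Rel (A ⊎ B) 0ℓ
OppositeSides (inj₁ _) (inj₁ _) = ⊥
OppositeSides (inj₁ _) (inj₂ _) = ⊤
OppositeSides (inj₂ _) (inj₁ _) = ⊤
OppositeSides (inj₂ _) (inj₂ _) = ⊥

oppositeSides? : ∀ {A B : Set} → Decidable (OppositeSides {A} {B})
oppositeSides? (inj₁ _) (inj₁ _) = no λ ()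
oppositeSides? (inj₁ _) (inj₂ _) = yes _
oppositeSides? (inj₂ _) (inj₁ _) = yes _
oppositeSides? (inj₂ _) (inj₂ _) = no λ ()

oppositeSides-sym : ∀ {A B : Set} → Symmetric (OppositeSides {A} {B})
oppositeSides-sym {_} {_} {inj₁ _} {inj₂ _} _ = _
oppositeSides-sym {_} {_} {inj₂ _} {inj₁ _} _ = _

oppositeSides-irrefl : ∀ {A B : Set} → Irreflexive _≡_ (OppositeSides {A} {B})
oppositeSides-irrefl {_} {_} {inj₁ _} refl ()
oppositeSides-irrefl {_} {_} {inj₂ _} refl ()

-- Fin (m + n) stands for Fin m ⊎ Fin n, via splitAt m.
completeBipartite : ∀ m n → Graph (m + n)
completeBipartite m n = record
  { Adj        = λ u v → OppositeSides (splitAt m u) (splitAt m v)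
  ; adj?       = λ u v → oppositeSides? (splitAt m u) (splitAt m v)
  ; adj-sym    = λ {u} {v} → oppositeSides-sym {x = splitAt m u} {splitAt m v}
  ; adj-irrefl = λ { {u} refl → oppositeSides-irrefl {x = splitAt m u} refl }
  }

module _ {m n} (G : Graph m) (H : Graph n) where

  BoxAdj : Rel (Fin m × Fin n) 0ℓ
  BoxAdj (u , x) (v , y) = (u ≡ v × Adj H x y) ⊎ (Adj G u v × x ≡ y)

  boxAdj? : Decidable BoxAdj
  boxAdj? (u , x) (v , y) =
    ((u ≟ v) ×-dec adj? H x y) ⊎-dec (adj? G u v ×-dec (x ≟ y))

  boxAdj-sym : Symmetric BoxAdj
  boxAdj-sym (inj₁ (u≡v , x~y)) = inj₁ (sym u≡v , adj-sym H x~y)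
  boxAdj-sym (inj₂ (u~v , x≡y)) = inj₂ (adj-sym G u~v , sym x≡y)

  boxAdj-irrefl : Irreflexive _≡_ BoxAdj
  boxAdj-irrefl refl (inj₁ (_ , x~x)) = adj-irrefl H refl x~x
  boxAdj-irrefl refl (inj₂ (u~u , _)) = adj-irrefl G refl u~u

infixr 7 _□_

-- Cartesian product; Fin (m * n) stands for Fin m × Fin n, via remQuot n.
_□_ : ∀ {m n} → Graph m → Graph n → Graph (m * n)
_□_ {m} {n} G H = record
  { Adj        = λ u v → BoxAdj G H (remQuot n u) (remQuot n v)
  ; adj?       = λ u v → boxAdj? G H (remQuot n u) (remQuot n v)
  ; adj-sym    = boxAdj-sym G H
  ; adj-irrefl = λ { refl → boxAdj-irrefl G H refl }
  }

K₃,₃ : Graph 6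
K₃,₃ = completeBipartite 3 3

prism : Graph 6
prism = complete 3 □ complete 2

module _ {n} (G : Graph n) where

  IsDominating : Subset n → Set
  IsDominating S = ∀ v → v ∉ S → ∃[ u ] u ∈ S × Adj G v u

  record IsCoalition (A B : Subset n) : Set where
    field
      disjoint        : Empty (A ∩ B)
      ¬dominatingˡ    : ¬ IsDominating A
      ¬dominatingʳ    : ¬ IsDominating B
      union-dominates : IsDominating (A ∪ B)

-- A partition into k nonempty sets, listed as V 0, …, V (k - 1); since the
-- sets are nonempty and pairwise disjoint, the list has no repetitions.
record IsPartition {n k} (V : Fin k → Subset n) : Set where
  field
    nonempty : ∀ i → Nonempty (V i)
    disjoint : ∀ i j → i ≢ j → Empty (V i ∩ V j)
    covers   : ∀ v → ∃[ i ] v ∈ V i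

record IsCPartition {n k} (G : Graph n) (V : Fin k → Subset n) : Set where
  field
    isPartition : IsPartition V
    condition   : ∀ i →
      (∣ V i ∣ ≡ 1 × IsDominating G (V i)) ⊎
      (¬ IsDominating G (V i) × ∃[ j ] j ≢ i × IsCoalition G (V i) (V j))

HasCPartition : ∀ {n} → Graph n → ℕ → Set
HasCPartition {n} G k = ∃ λ (V : Fin k → Subset n) → IsCPartition G V

-- The coalition number C(G) is c: c is the largest k for which G has a
-- c-partition with k sets.
record CoalitionNumber {n} (G : Graph n) (c : ℕ) : Set where
  field
    attained : HasCPartition G c
    maximal  : ∀ k → HasCPartition G k → k ≤ c

{-# OPTIONS --safe #-}
module Submission where

open import Data.Bool using (Bool; true; false)
import Data.Bool.Properties as Bool
open import Data.Fin using (Fin; zero; suc; _≟_)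
open import Data.Fin.Permutation
  using (Permutation; _⟨$⟩ʳ_; _⟨$⟩ˡ_; _∘ₚ_; id; lift₀; transpose; inverseʳ)
open import Data.Fin.Properties using (all?; any?; injective⇒≤)
open import Data.Fin.Subset using (Subset; Empty; _∈_; _∩_; _∪_; ∣_∣; ⁅_⁆)
open import Data.Fin.Subset.Properties
  using (_∈?_; x∈⁅x⁆; x∈⁅y⁆⇒x≡y; x∈p∩q⁺; x∈p∩q⁻)
open import Data.List using (List; [_]; allFin; cartesianProductWith)
import Data.List.Relation.Unary.Any as Any
open import Data.Nat using (ℕ; zero; suc; _≤_)
import Data.Nat.Properties as ℕ
open import Data.Product using (_×_; _,_; ∃-syntax; proj₁; proj₂)
import Data.Sum as Sum
open import Data.Sum using (_⊎_; inj₂)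
open import Data.Unit using (⊤; tt)
open import Data.Vec using (Vec; []; _∷_; tabulate; lookup)
open import Data.Vec.Properties using (tabulate-cong; lookup∘tabulate)
open import Function using (_∘_)
open import Function.Bundles using (_⇔_; mk⇔; module Equivalence)
open import Relation.Binary.PropositionalEquality
  using (_≡_; _≢_; refl; sym; trans; cong; subst; subst₂; ≢-sym)
open import Relation.Nullary using (¬_; Dec; yes; no; does; contradiction)
open import Relation.Nullary.Decidable
  using (map′; toWitness; from-yes; from-no; decidable-stable; ¬?; _×-dec_; _⊎-dec_; _→-dec_;
         does-⇔; dec-false)
open import Defs

-- A partition of 6 vertices has at most 6 nonempty sets, and in both graphs the
-- singletons form a c-partition: no vertex dominates on its own, but every
-- vertex lies in a dominating pair.  The two graphs differ in that only the
-- prism has a triangle.  The classification is by computation: for each of the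
-- 2¹⁵ labelled graphs on 6 vertices that is cubic, one of the 720 vertex
-- bijections is an isomorphism with one of the two graphs.

-- Row v records the adjacencies of v to the later vertices.
UpperTriangle : ℕ → Set
UpperTriangle zero    = ⊤
UpperTriangle (suc n) = Vec Bool n × UpperTriangle n

entry : ∀ {n} → UpperTriangle n → Fin n → Fin n → Bool
entry (r , t) zero    zero    = false
entry (r , t) zero    (suc v) = lookup r v
entry (r , t) (suc u) zero    = lookup r u
entry (r , t) (suc u) (suc v) = entry t u v

upperTriangle : ∀ {n} → (Fin n → Fin n → Bool) → UpperTriangle n
upperTriangle {zero}  f = tt
upperTriangle {suc n} f =
  tabulate (f zero ∘ suc) , upperTriangle (λ u v → f (suc u) (suc v))

-- Only entries above the diagonal are stored: those below are recovered by symmetry, those on it by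
-- irreflexivity.
entry-upperTriangle : ∀ {n} (f : Fin n → Fin n → Bool) →
  (∀ u v → f u v ≡ f v u) → (∀ v → f v v ≡ false) →
  ∀ u v → entry (upperTriangle f) u v ≡ f u v
entry-upperTriangle f s i zero    zero    = sym (i zero)
entry-upperTriangle f s i zero    (suc v) = lookup∘tabulate (f zero ∘ suc) v
entry-upperTriangle f s i (suc u) zero    =
  trans (lookup∘tabulate (f zero ∘ suc) u) (s zero (suc u))
entry-upperTriangle f s i (suc u) (suc v) =
  entry-upperTriangle _ (λ x y → s (suc x) (suc y)) (i ∘ suc) u v

allBool? : {P : Bool → Set} → (∀ b → Dec (P b)) → Dec (∀ b → P b)
allBool? P? = map′
  (λ { (t , f) true → t ; (t , f) false → f }) (λ p → p true , p false)
  (P? true ×-dec P? false)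

allVec? : ∀ {n} {P : Vec Bool n → Set} → (∀ r → Dec (P r)) → Dec (∀ r → P r)
allVec? {zero}  P? = map′ (λ { p [] → p }) (λ p → p []) (P? [])
allVec? {suc n} P? = map′ (λ { p (b ∷ r) → p b r }) (λ p b r → p (b ∷ r))
  (allBool? λ b → allVec? λ r → P? (b ∷ r))

-- A `Graph` carries an arbitrary decidable relation and cannot be enumerated; its Boolean encoding
-- can, one bit at a time.
allUpperTriangle? : ∀ {n} {P : UpperTriangle n → Set} → (∀ t → Dec (P t)) → Dec (∀ t → P t)
allUpperTriangle? {zero}  P? = map′ (λ { p tt → p }) (λ p → p tt) (P? tt)
allUpperTriangle? {suc n} P? = map′ (λ { p (r , t) → p r t }) (λ p r t → p (r , t))
  (allVec? λ r → allUpperTriangle? λ t → P? (r , t))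

-- A permutation is fixed by the image `i` of `zero` and a permutation of the rest: `lift₀ σ` fixes
-- `zero`, then the transposition moves it to `i`.
permutations : ∀ n → List (Permutation n n)
permutations zero    = [ id ]
permutations (suc n) = cartesianProductWith
  (λ i σ → lift₀ σ ∘ₚ transpose zero i) (allFin (suc n)) (permutations n)

module _ {n} (t : UpperTriangle n) where

  Cubic : Set
  Cubic = ∀ v → ∣ tabulate (entry t v) ∣ ≡ 3

  cubic? : Dec Cubic
  cubic? = all? λ v → _ ℕ.≟ 3

  -- Adjacency is compared as truth values, so that the test evaluates; `does-≡⇒⇔` later recovers
  -- the equivalences that `_≅_` asks for.
  IsIso : Graph n → Permutation n n → Set
  IsIso H σ = ∀ u v → entry t u v ≡ does (adj? H (σ ⟨$⟩ʳ u) (σ ⟨$⟩ʳ v))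

  FindsIso : Graph n → Set
  FindsIso H = Any.Any (IsIso H) (permutations n)

  findsIso? : ∀ H → Dec (FindsIso H)
  findsIso? H = Any.any? (λ σ → all? λ u → all? λ v → _ Bool.≟ _) (permutations n)

abstract
  -- The prism comes first since 60 of the 70 labelled cubic graphs are prisms.
  cubic-upperTriangles-of-order-6 : (t : UpperTriangle 6) → Cubic t → FindsIso t prism ⊎ FindsIso t K₃,₃
  cubic-upperTriangles-of-order-6 = toWitness
    -- With cubicity tested first, the search through the bijections runs only on the cubic
    -- encodings.
    {a? = allUpperTriangle? λ t → cubic? t →-dec (findsIso? t prism ⊎-dec findsIso? t K₃,₃)} _

does-≡⇒⇔ : {A B : Set} (a? : Dec A) (b? : Dec B) → does a? ≡ does b? → A ⇔ B
does-≡⇒⇔ (yes a) (yes b) _ = mk⇔ (λ _ → b) (λ _ → a)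
does-≡⇒⇔ (no ¬a) (no ¬b) _ = mk⇔ (λ a → contradiction a ¬a) (λ b → contradiction b ¬b)

module _ {n} (G : Graph n) where

  adjacency : Fin n → Fin n → Bool
  adjacency u v = does (adj? G u v)

  entry-adjacency : ∀ u v → entry (upperTriangle adjacency) u v ≡ adjacency u v
  entry-adjacency = entry-upperTriangle adjacency
    (λ u v → does-⇔ (mk⇔ (adj-sym G) (adj-sym G)) (adj? G u v) (adj? G v u))
    (λ v → dec-false (adj? G v v) (adj-irrefl G refl))

  cubic-upperTriangle : IsCubic G → Cubic (upperTriangle adjacency)
  cubic-upperTriangle c v =
    trans (cong ∣_∣ (tabulate-cong (entry-adjacency v))) (c v)

  findsIso⇒≅ : ∀ H → FindsIso (upperTriangle adjacency) H → G ≅ H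
  findsIso⇒≅ H found = let σ , iso = Any.satisfied found in
    σ , λ u v → does-≡⇒⇔ (adj? G u v) (adj? H _ _)
      (trans (sym (entry-adjacency u v)) (iso u v))

cubic-order-6 : (G : Graph 6) → IsCubic G → (G ≅ K₃,₃) ⊎ (G ≅ prism)
cubic-order-6 G c = Sum.swap (Sum.map (findsIso⇒≅ G prism) (findsIso⇒≅ G K₃,₃)
  (cubic-upperTriangles-of-order-6 (upperTriangle (adjacency G)) (cubic-upperTriangle G c)))

HasTriangle : ∀ {n} → Graph n → Set
HasTriangle G = ∃[ u ] ∃[ v ] ∃[ w ] Adj G u v × Adj G v w × Adj G u w

hasTriangle? : ∀ {n} (G : Graph n) → Dec (HasTriangle G)
hasTriangle? G =
  any? λ u → any? λ v → any? λ w → adj? G u v ×-dec adj? G v w ×-dec adj? G u w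

-- The inverse bijection carries edges of `H` back to edges of `G`. This separates the prism from
-- `K₃,₃`, which is bipartite.
≅-reflects-triangles : ∀ {m n} (G : Graph m) (H : Graph n) →
  G ≅ H → HasTriangle H → HasTriangle G
≅-reflects-triangles G H (f , iso) (u , v , w , uv , vw , uw) =
  _ , _ , _ , pull uv , pull vw , pull uw
  where
  pull : ∀ {x y} → Adj H x y → Adj G (f ⟨$⟩ˡ x) (f ⟨$⟩ˡ y)
  pull a = Equivalence.from (iso _ _)
    (subst₂ (Adj H) (sym (inverseʳ f)) (sym (inverseʳ f)) a)

K₃,₃≇prism : ¬ (K₃,₃ ≅ prism)
K₃,₃≇prism i = from-no (hasTriangle? K₃,₃)
  (≅-reflects-triangles K₃,₃ prism i (from-yes (hasTriangle? prism)))

-- Choosing an element from each part gives an injection `Fin k → Fin n`, since distinct parts share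
-- no element.
partition-size : ∀ {n k} {V : Fin k → Subset n} → IsPartition V → k ≤ n
partition-size {V = V} P = injective⇒≤ {f = proj₁ ∘ nonempty} injective
  where
  open IsPartition P
  injective : ∀ {i j} → proj₁ (nonempty i) ≡ proj₁ (nonempty j) → i ≡ j
  injective {i} {j} eq = decidable-stable (i ≟ j) λ i≢j → disjoint i j i≢j
    (_ , x∈p∩q⁺ (proj₂ (nonempty i) , subst (_∈ V j) (sym eq) (proj₂ (nonempty j))))

⁅⁆-disjoint : ∀ {n} {u v : Fin n} → u ≢ v → Empty (⁅ u ⁆ ∩ ⁅ v ⁆)
⁅⁆-disjoint {u = u} {v} u≢v (x , x∈) with x∈p∩q⁻ ⁅ u ⁆ ⁅ v ⁆ x∈
... | x∈u , x∈v = u≢v (trans (sym (x∈⁅y⁆⇒x≡y u x∈u)) (x∈⁅y⁆⇒x≡y v x∈v))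

singletons : ∀ {n} → IsPartition {n} ⁅_⁆
singletons = record
  { nonempty = λ v → v , x∈⁅x⁆ v
  ; disjoint = λ _ _ → ⁅⁆-disjoint
  ; covers   = λ v → v , x∈⁅x⁆ v
  }

module _ {n} (G : Graph n) where

  isDominating? : ∀ S → Dec (IsDominating G S)
  isDominating? S = all? λ v → ¬? (v ∈? S) →-dec any? λ u → u ∈? S ×-dec adj? G v u

  NoDominatingVertex : Set
  NoDominatingVertex = ∀ v → ¬ IsDominating G ⁅ v ⁆

  noDominatingVertex? : Dec NoDominatingVertex
  noDominatingVertex? = all? λ v → ¬? (isDominating? ⁅ v ⁆)

  EachInDominatingPair : Set
  EachInDominatingPair = ∀ u → ∃[ v ] v ≢ u × IsDominating G (⁅ u ⁆ ∪ ⁅ v ⁆)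

  eachInDominatingPair? : Dec EachInDominatingPair
  eachInDominatingPair? = all? λ u → any? λ v →
    ¬? (v ≟ u) ×-dec isDominating? (⁅ u ⁆ ∪ ⁅ v ⁆)

  coalitionNumber≡order :
    NoDominatingVertex → EachInDominatingPair → CoalitionNumber G n
  coalitionNumber≡order ¬dom pair = record
    { attained = ⁅_⁆ , record
      { isPartition = singletons
      ; condition   = λ u → let v , v≢u , dom = pair u in
          inj₂ (¬dom u , v , v≢u , record
            { disjoint        = ⁅⁆-disjoint (≢-sym v≢u)
            ; ¬dominatingˡ    = ¬dom u
            ; ¬dominatingʳ    = ¬dom v
            ; union-dominates = dom
            })
      }
    ; maximal = λ _ (_ , P) → partition-size (IsCPartition.isPartition P)
    }

theorem2p5 : (IsCubic K₃,₃ × IsCubic prism × ¬ (K₃,₃ ≅ prism) ×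
    ((G : Graph 6) → IsCubic G → (G ≅ K₃,₃) ⊎ (G ≅ prism))) ×
    (CoalitionNumber K₃,₃ 6 × CoalitionNumber prism 6)
theorem2p5 =
  ( from-yes (all? λ v → degree K₃,₃ v ℕ.≟ 3)
  , from-yes (all? λ v → degree prism v ℕ.≟ 3)
  , K₃,₃≇prism
  , cubic-order-6
  ) ,
  -- A vertex of a cubic graph dominates four vertices and so misses two of the six. In `K₃,₃` any
  -- vertex of the other side covers these two; in `prism` the copy of the vertex in the other
  -- triangle does.
  ( coalitionNumber≡order K₃,₃
      (from-yes (noDominatingVertex? K₃,₃)) (from-yes (eachInDominatingPair? K₃,₃))
  , coalitionNumber≡order prism
      (from-yes (noDominatingVertex? prism)) (from-yes (eachInDominatingPair? prism))
  )
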